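{- $\pi((\square P)^3)\le 28$.
   Context: $P$ is the two-way infinite path with vertex set $\mathbb{Z}$ ($i\sim i+1$). $(\square P)^3$ is the $3$-fold Cartesian product of $P$, i.e. the graph on $\mathbb{Z}^3$ in which two vertices are adjacent iff they differ by exactly $1$ in exactly one coordinate. A vertex coloring $c$ of a graph is non-repetitive if there is no path $v_1,\dots,v_{2k}$ ($k\ge1$, distinct vertices, consecutive ones adjacent) with $c(v_i)=c(v_{k+i})$ for all $1\le i\le k$; $\pi(G)$ denotes the minimum number of colors in a non-repetitive coloring of $G$. -}

module Defs where

open import Data.Nat using (ℕ; suc; _+_; _<_; _≤_)
open import Data.Integer using (ℤ; ∣_∣; _-_)
open import Data.Fin using (Fin; toℕ; fromℕ<)
open import Data.Product using (_×_; _,_; Σ)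
open import Data.Sum using (_⊎_)
open import Relation.Binary.PropositionalEquality using (_≡_)
open import Relation.Nullary using (¬_)
open import Function.Definitions using (Injective)

record Graph : Set₁ where
  field
    V   : Set
    Adj : V → V → Set
open Graph public

record IsPath (G : Graph) (n : ℕ) (p : Fin n → V G) : Set where
  field
    distinct : Injective _≡_ _≡_ p
    adjacent : (i : Fin n) (j : Fin n) → toℕ j ≡ suc (toℕ i) → Adj G (p i) (p j)

-- A path v₁ … v_{2k} (k ≥ 1) is repetitively coloured by c if c(vᵢ) = c(v_{k+i}) for all i ≤ k.
-- Indices are 0-based: vertex i ↔ Fin (k + k) with i < k, and its partner k + i.
Repetitive : {G : Graph} {C : Set} (c : V G → C) (k : ℕ) (p : Fin (k + k) → V G) → Set
Repetitive c k p =
  (i : ℕ) (h₁ : i < k + k) (h₂ : k + i < k + k) → i < k → c (p (fromℕ< h₁)) ≡ c (p (fromℕ< h₂))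

NonRepetitive : (G : Graph) {C : Set} (c : V G → C) → Set
NonRepetitive G c =
  (k : ℕ) → 1 ≤ k → (p : Fin (k + k) → V G) → IsPath G (k + k) p → ¬ Repetitive {G} c k p

πLe : Graph → ℕ → Set
πLe G m = Σ (V G → Fin m) (NonRepetitive G)

AdjP : ℤ → ℤ → Set
AdjP a b = ∣ a - b ∣ ≡ 1

AdjP3 : ℤ × ℤ × ℤ → ℤ × ℤ × ℤ → Set
AdjP3 (x , y , z) (x' , y' , z') =
    (AdjP x x' × y ≡ y' × z ≡ z')
  ⊎ (x ≡ x' × AdjP y y' × z ≡ z')
  ⊎ (x ≡ x' × y ≡ y' × AdjP z z')

P³ : Graph
P³ = record { V = ℤ × ℤ × ℤ ; Adj = AdjP3 }

{-# OPTIONS --safe #-}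

-- Let d : ℤ → ℤ/4 satisfy d(5q + r) = d(q) + (0,1,3,1,0)ᵣ with d(0) = 0, d(−1) = 1, and let h have
-- differences h(x+1) − h(x) = d(x).  Colour (x,y,z) by x + 2y + 3z mod 7 and h(x) + h(y) + h(z) mod 4.
-- The residue mod 7 reveals the direction of every step, so the second half of a repetitively
-- coloured path is the first half translated by some w; the residue mod 4 then gives
-- d(t) = d(t + wₗ) for every edge {t, t+1} that the l-th coordinate crosses in the first half.
-- If the middle step is not along axis l, the crossed edges cover the whole interval from vₗ to
-- vₗ + wₗ, so wₗ ≠ 0 would give a square in d.  For the remaining axis j one edge may be missing,
-- but there 7 divides wⱼ, and d has no factor of length 2a − 1 and period a for a ≥ 5 either.
-- Hence w = 0, contradicting distinctness.
--
-- Both properties of d follow from synchronisation: equal factors of length 4 occur only at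
-- positions congruent mod 5, so a long repetition has period 5a′ and descends to a square of
-- period a′, and squares of period at most 3 are excluded by inspecting two adjacent blocks.
module Submission where

open import Defs

open import Data.Bool using (if_then_else_)
open import Data.Nat as ℕ using (ℕ; zero; suc; z≤n; s≤s; _<ᵇ_; NonZero)
import Data.Nat.Properties as ℕ
open import Data.Nat.Coprimality using (Coprime; coprime?)
open import Data.Nat.DivMod using (_/_; _mod_; _divMod_; result; m/n≤m; m/n<m; [m+kn]%n≡m%n;
  +-distrib-/-∣ʳ; m*n/n≡m; m<n⇒m%n≡m; m<n⇒m/n≡0)
open import Data.Nat.Divisibility using (divides; n∣m*n; ∣⇒≤) renaming (_∣_ to _ℕ∣_)
open import Data.Nat.Induction using (<-rec)
import Data.Nat.Tactic.RingSolver as ℕ-Ring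
open import Data.Integer using (ℤ; +_; -[1+_]; _+_; _*_; _-_; -_; ∣_∣; _%ℕ_; _/ℕ_)
open import Data.Integer.Properties using (i-j≡0⇒i≡j; +-injective; +-assoc; +-identityˡ; +-inverseʳ; pos-*)
open import Data.Integer.Coprimality using (coprime-divisor)
open import Data.Integer.DivMod using (n%ℕd<d; a≡a%ℕn+[a/ℕn]*n)
open import Data.Integer.Divisibility.Signed using (_∣_; divides; _∣?_; ∣⇒∣ᵤ; ∣ᵤ⇒∣; ∣m⇒∣-m;
  ∣m∣n⇒∣m-n)
open import Data.Integer.Tactic.RingSolver using (solve-∀)
open import Data.Fin using (Fin; toℕ; fromℕ<; combine)
open import Data.Fin.Patterns
open import Data.Fin.Properties using (all?; _≟_; toℕ<n; toℕ-fromℕ<; toℕ-injective;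
  fromℕ<-injective; combine-injective)
open import Data.Empty using (⊥-elim)
open import Data.Product using (_×_; _,_; ∃; ∃₂; ∃-syntax; proj₁; proj₂)
open import Data.Sum using (_⊎_; inj₁; inj₂)
open import Relation.Binary.PropositionalEquality
open import Relation.Nullary using (¬_; ¬?; yes; no; contradiction)
open import Relation.Nullary.Decidable using (from-yes; _→-dec_; _×-dec_)
open ≡-Reasoning

-- The substitution on four letters and its finite checks.

rot : Fin 4 → Fin 4
rot 0F = 1F
rot 1F = 2F
rot 2F = 3F
rot 3F = 0F

σ : Fin 4 → Fin 5 → Fin 4
σ p 0F = p
σ p 1F = rot p
σ p 2F = rot (rot (rot p))
σ p 3F = rot p
σ p 4F = p

-- The letters of the two-block word σ(p)σ(p′), indexed by n < 10.
σ₂ : Fin 4 → Fin 4 → ℕ → Fin 4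
σ₂ p p′ n = σ (if n <ᵇ 5 then p else p′) (n mod 5)

-- Decided by enumeration. Inequality is all that will be known of neighbouring letters of `d`, so
-- all twelve ordered pairs are tried on either side.
σ₂-sync : ∀ p p′ → p ≢ p′ → ∀ t t′ → t ≢ t′ → ∀ (r u : Fin 5) →
          (∀ (i : Fin 4) → σ₂ p p′ (toℕ i ℕ.+ toℕ r) ≡ σ₂ t t′ (toℕ i ℕ.+ toℕ u)) → r ≡ u
σ₂-sync = from-yes (all? λ p → all? λ p′ → ¬? (p ≟ p′) →-dec all? λ t → all? λ t′ → ¬? (t ≟ t′) →-dec
  all? λ (r : Fin 5) → all? λ (u : Fin 5) →
  all? (λ (i : Fin 4) → σ₂ p p′ (toℕ i ℕ.+ toℕ r) ≟ σ₂ t t′ (toℕ i ℕ.+ toℕ u)) →-dec (r ≟ u))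

-- A square of period at most 3 that starts in the first block ends at index 9 or earlier, so two
-- blocks contain it.
σ₂-short : ∀ p p′ → p ≢ p′ → ∀ (a : Fin 3) (r : Fin 5) →
           ¬ (∀ (i : Fin (suc (toℕ a))) →
                σ₂ p p′ (toℕ i ℕ.+ toℕ r) ≡ σ₂ p p′ (toℕ i ℕ.+ suc (toℕ a) ℕ.+ toℕ r))
σ₂-short = from-yes (all? λ p → all? λ p′ → ¬? (p ≟ p′) →-dec all? λ (a : Fin 3) → all? λ (r : Fin 5) →
  ¬? (all? λ (i : Fin (suc (toℕ a))) →
        σ₂ p p′ (toℕ i ℕ.+ toℕ r) ≟ σ₂ p p′ (toℕ i ℕ.+ suc (toℕ a) ℕ.+ toℕ r)))

σ-adjacent : ∀ p (r : Fin 4) → σ₂ p p (toℕ r) ≢ σ₂ p p (suc (toℕ r))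
σ-adjacent = from-yes (all? λ p → all? λ (r : Fin 4) → ¬? (σ₂ p p (toℕ r) ≟ σ₂ p p (suc (toℕ r))))

-- The fixed point of `σ` on the natural numbers.

digitSumFuel : ℕ → ℕ → Fin 4
digitSumFuel zero    n = 0F
digitSumFuel (suc k) n = σ (digitSumFuel k (n / 5)) (n mod 5)

-- The sum mod 4 of the values (0,1,3,1,0) taken at the base-5 digits of n; n itself is enough fuel
-- for the recursion on n / 5.
digitSum : ℕ → Fin 4
digitSum n = digitSumFuel n n

digitSumFuel-0 : ∀ k → digitSumFuel k 0 ≡ 0F
digitSumFuel-0 zero    = refl
digitSumFuel-0 (suc k) = digitSumFuel-0 k

-- For n > 0 the recursive call uses one unit of fuel and n / 5 < n, so any fuel of at least n gives
-- the same value.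
digitSumFuel-stable : ∀ k l n → n ℕ.≤ k → n ℕ.≤ l → digitSumFuel k n ≡ digitSumFuel l n
digitSumFuel-stable k       l       zero    _   _   = trans (digitSumFuel-0 k) (sym (digitSumFuel-0 l))
digitSumFuel-stable (suc k) (suc l) n@(suc _) n≤k n≤l =
  cong (λ p → σ p (n mod 5)) (digitSumFuel-stable k l (n / 5) (bound n≤k) (bound n≤l))
  where
  bound : ∀ {k} → n ℕ.≤ suc k → n / 5 ℕ.≤ k
  bound n≤1+k = ℕ.s≤s⁻¹ (ℕ.≤-trans (m/n<m n 5 (s≤s (s≤s z≤n))) n≤1+k)

digitSum-unfold : ∀ n → digitSum n ≡ σ (digitSum (n / 5)) (n mod 5)
digitSum-unfold n = trans (digitSumFuel-stable n (suc n) n ℕ.≤-refl (ℕ.n≤1+n n))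
  (cong (λ p → σ p (n mod 5)) (digitSumFuel-stable n (n / 5) (n / 5) (m/n≤m n 5) ℕ.≤-refl))

digitSum-digits : ∀ q r → digitSum (toℕ r ℕ.+ q ℕ.* 5) ≡ σ (digitSum q) r
digitSum-digits q r = trans (digitSum-unfold n) (cong₂ (λ m → σ (digitSum m)) quotient remainder)
  where
  n = toℕ r ℕ.+ q ℕ.* 5
  quotient : n / 5 ≡ q
  quotient = trans (+-distrib-/-∣ʳ (toℕ r) (n∣m*n q)) (cong₂ ℕ._+_ (m<n⇒m/n≡0 (toℕ<n r)) (m*n/n≡m q 5))
  remainder : n mod 5 ≡ r
  remainder = toℕ-injective (trans (toℕ-fromℕ< _)
    (trans ([m+kn]%n≡m%n (toℕ r) q 5) (m<n⇒m%n≡m (toℕ<n r))))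

digitSum-adjacent : ∀ n → digitSum n ≢ digitSum (suc n)
digitSum-adjacent = <-rec _ step
  where
  within : ∀ q (r : Fin 4) → digitSum (toℕ r ℕ.+ q ℕ.* 5) ≢ digitSum (suc (toℕ r) ℕ.+ q ℕ.* 5)
  within q 0F e = σ-adjacent (digitSum q) 0F (trans (sym (digitSum-digits q 0F)) (trans e (digitSum-digits q 1F)))
  within q 1F e = σ-adjacent (digitSum q) 1F (trans (sym (digitSum-digits q 1F)) (trans e (digitSum-digits q 2F)))
  within q 2F e = σ-adjacent (digitSum q) 2F (trans (sym (digitSum-digits q 2F)) (trans e (digitSum-digits q 3F)))
  within q 3F e = σ-adjacent (digitSum q) 3F (trans (sym (digitSum-digits q 3F)) (trans e (digitSum-digits q 4F)))

  step : ∀ n → (∀ {m} → m ℕ.< n → digitSum m ≢ digitSum (suc m)) → digitSum n ≢ digitSum (suc n)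
  step n rec with n divMod 5
  ... | result q 0F refl = within q 0F
  ... | result q 1F refl = within q 1F
  ... | result q 2F refl = within q 2F
  ... | result q 3F refl = within q 3F
  -- Across a block boundary the two letters are those of q and q + 1, since `σ p` begins and ends
  -- with p.
  ... | result q 4F refl = λ e →
    rec (s≤s (ℕ.≤-trans (ℕ.m≤m*n q 5) (ℕ.m≤n+m _ 3)))
        (trans (sym (digitSum-digits q 4F)) (trans e (digitSum-digits (suc q) 0F)))

-- The two-sided sequence and its blocks.

-- The recursion leaves the value at -1 free, because -1 = 5·(-1) + 4 and the last letter of `σ p`
-- is p. The rotation makes it 1, different from the value 0 at 0.
d : ℤ → Fin 4
d (+ n)    = digitSum n
d -[1+ n ] = rot (digitSum n)

rot-injective : ∀ p p′ → rot p ≡ rot p′ → p ≡ p′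
rot-injective = from-yes (all? λ p → all? λ p′ → (rot p ≟ rot p′) →-dec (p ≟ p′))

-- −1 − n has the reversed digits of n in base 5, and σ is palindromic.
d-digits : ∀ q r → d (+ toℕ r + q * + 5) ≡ σ (d q) r
d-digits (+ n) r = trans (cong (λ z → d (+ toℕ r + z)) (sym (pos-* n 5))) (digitSum-digits n r)
d-digits -[1+ n ] 0F = cong rot (digitSum-digits n 4F)
d-digits -[1+ n ] 1F = cong rot (digitSum-digits n 3F)
d-digits -[1+ n ] 2F = cong rot (digitSum-digits n 2F)
d-digits -[1+ n ] 3F = cong rot (digitSum-digits n 1F)
d-digits -[1+ n ] 4F = cong rot (digitSum-digits n 0F)

d-adjacent : ∀ x → d x ≢ d (+ 1 + x)
d-adjacent (+ n)          = digitSum-adjacent n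
d-adjacent -[1+ zero ]  ()
d-adjacent -[1+ suc n ] e = digitSum-adjacent n (sym (rot-injective _ _ e))

digits : ∀ x → ∃₂ λ q (r : Fin 5) → x ≡ + toℕ r + q * + 5
digits x = x /ℕ 5 , fromℕ< (n%ℕd<d x 5) ,
  trans (a≡a%ℕn+[a/ℕn]*n x 5) (cong (λ r → + r + (x /ℕ 5) * + 5) (sym (toℕ-fromℕ< _)))

d-σ₂ : ∀ q {n} → n ℕ.< 10 → d (+ n + q * + 5) ≡ σ₂ (d q) (d (+ 1 + q)) n
d-σ₂ q n<10 = subst (λ n → d (+ n + q * + 5) ≡ σ₂ (d q) (d (+ 1 + q)) n) (toℕ-fromℕ< n<10) (go (fromℕ< n<10))
  where
  carry : ∀ z q → + 5 + z + q * + 5 ≡ z + (+ 1 + q) * + 5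
  carry = solve-∀

  next : ∀ r → d (+ (5 ℕ.+ toℕ r) + q * + 5) ≡ σ (d (+ 1 + q)) r
  next r = trans (cong d (carry (+ toℕ r) q)) (d-digits (+ 1 + q) r)

  go : ∀ (j : Fin 10) → d (+ toℕ j + q * + 5) ≡ σ₂ (d q) (d (+ 1 + q)) (toℕ j)
  go 0F = d-digits q 0F
  go 1F = d-digits q 1F
  go 2F = d-digits q 2F
  go 3F = d-digits q 3F
  go 4F = d-digits q 4F
  go 5F = next 0F
  go 6F = next 1F
  go 7F = next 2F
  go 8F = next 3F
  go 9F = next 4F

d-window : ∀ q (r : Fin 5) {i} → i ℕ.≤ 5 → d (+ i + (+ toℕ r + q * + 5)) ≡ σ₂ (d q) (d (+ 1 + q)) (i ℕ.+ toℕ r)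
d-window q r {i} i≤5 = trans (cong d (sym (+-assoc (+ i) (+ toℕ r) (q * + 5))))
  (d-σ₂ q (ℕ.+-mono-≤-< i≤5 (toℕ<n r)))

-- Synchronisation, desubstitution and square-freeness.

d-sync : ∀ x y → (∀ i → i ℕ.< 4 → d (+ i + x) ≡ d (+ i + y)) → + 5 ∣ y - x
d-sync x y eq with digits x | digits y
... | q , r , refl | t , u , refl = divides (t - q) (trans (cong (λ r → + toℕ u + t * + 5 - (+ toℕ r + q * + 5)) r≡u)
                                                        (difference (+ toℕ u) t q))
  where
  difference : ∀ u t q → u + t * + 5 - (u + q * + 5) ≡ (t - q) * + 5
  difference = solve-∀

  i≤5 : (i : Fin 4) → toℕ i ℕ.≤ 5
  i≤5 i = ℕ.≤-trans (ℕ.<⇒≤ (toℕ<n i)) (ℕ.n≤1+n 4)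

  -- Each window lies in the image of two adjacent letters of `d`, and these differ.
  r≡u : r ≡ u
  r≡u = σ₂-sync _ _ (d-adjacent q) _ _ (d-adjacent t) r u λ i →
    trans (sym (d-window q r (i≤5 i))) (trans (eq (toℕ i) (toℕ<n i)) (d-window t u (i≤5 i)))

Square : ℕ → ℤ → Set
Square a x = ∀ i → i ℕ.< a → d (+ i + x) ≡ d (+ (i ℕ.+ a) + x)

AlmostSquare : ℕ → ℤ → Set
AlmostSquare a x = ∀ i → suc i ℕ.< a → d (+ i + x) ≡ d (+ (i ℕ.+ a) + x)

prefix⇒5∣ : ∀ a x → (∀ i → i ℕ.< 4 → d (+ i + x) ≡ d (+ (i ℕ.+ a) + x)) → ∃[ b ] a ≡ b ℕ.* 5
prefix⇒5∣ a x eq = multiple (∣⇒∣ᵤ (subst (+ 5 ∣_) (cancel (+ a) x) (d-sync x (+ a + x) λ i i<4 →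
  trans (eq i i<4) (cong d (+-assoc (+ i) (+ a) x)))))
  where
  cancel : ∀ a x → a + x - x ≡ a
  cancel = solve-∀

  multiple : 5 ℕ∣ a → ∃[ b ] a ≡ b ℕ.* 5
  multiple (divides b a≡b*5) = b , a≡b*5

-- σ p has p at both ends, so some position among any four consecutive ones carries a letter of the preimage.
anchor : ∀ x → ∃[ c ] ∃[ q ] c ℕ.≤ 3 × (∀ i → d (+ (i ℕ.* 5 ℕ.+ c) + x) ≡ d (+ i + q))
anchor x with digits x
... | q , r , refl = helper r
  where
  shift : ∀ i c r q → (i * + 5 + c) + (r + q * + 5) ≡ (c + r) + (i + q) * + 5
  shift = solve-∀

  move : ∀ c r i → + (i ℕ.* 5 ℕ.+ c) + (+ r + q * + 5) ≡ + (c ℕ.+ r) + (+ i + q) * + 5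
  move c r i = trans (cong (λ z → z + + c + (+ r + q * + 5)) (pos-* i 5)) (shift (+ i) (+ c) (+ r) q)

  first last : ∀ i → d (+ _ + (+ i + q) * + 5) ≡ d (+ i + q)
  first i = d-digits (+ i + q) 0F
  last  i = d-digits (+ i + q) 4F

  helper : ∀ r → ∃[ c ] ∃[ q′ ] c ℕ.≤ 3 × (∀ i → d (+ (i ℕ.* 5 ℕ.+ c) + (+ toℕ r + q * + 5)) ≡ d (+ i + q′))
  helper 0F = 0 , q , z≤n , λ i → trans (cong d (move 0 0 i)) (first i)
  helper 1F = 3 , q , ℕ.≤-refl , λ i → trans (cong d (move 3 1 i)) (last i)
  helper 2F = 2 , q , s≤s (s≤s z≤n) , λ i → trans (cong d (move 2 2 i)) (last i)
  helper 3F = 1 , q , s≤s z≤n , λ i → trans (cong d (move 1 3 i)) (last i)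
  helper 4F = 0 , q , z≤n , λ i → trans (cong d (move 0 4 i)) (last i)

-- The anchored positions 5i + c with i < a and c ≤ 3 reach at most 5a - 2, so the equality absent
-- from an almost square is never called for.
desubstitute : ∀ a x → AlmostSquare (a ℕ.* 5) x → ∃ (Square a)
desubstitute a x sq with anchor x
... | c , q , c≤3 , eq = q , λ i i<a → begin
  d (+ i + q)                                  ≡⟨ eq i ⟨
  d (+ (i ℕ.* 5 ℕ.+ c) + x)                    ≡⟨ sq (i ℕ.* 5 ℕ.+ c) (inside i i<a) ⟩
  d (+ (i ℕ.* 5 ℕ.+ c ℕ.+ a ℕ.* 5) + x)        ≡⟨ cong (λ n → d (+ n + x)) (regroup i c a) ⟩
  d (+ ((i ℕ.+ a) ℕ.* 5 ℕ.+ c) + x)            ≡⟨ eq (i ℕ.+ a) ⟩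
  d (+ (i ℕ.+ a) + q)                          ∎
  where
  regroup : ∀ i c a → i ℕ.* 5 ℕ.+ c ℕ.+ a ℕ.* 5 ≡ (i ℕ.+ a) ℕ.* 5 ℕ.+ c
  regroup = ℕ-Ring.solve-∀

  inside : ∀ i → i ℕ.< a → suc (i ℕ.* 5 ℕ.+ c) ℕ.< a ℕ.* 5
  inside i i<a = ℕ.≤-trans
    (subst (λ n → suc (suc n) ℕ.≤ suc i ℕ.* 5) (ℕ.+-comm c (i ℕ.* 5)) (s≤s (s≤s (ℕ.+-monoˡ-≤ (i ℕ.* 5) c≤3))))
    (ℕ.*-monoˡ-≤ 5 i<a)

d-squareFree : ∀ a x → 0 ℕ.< a → ¬ Square a x
d-squareFree = <-rec _ step
  where
  short : ∀ (a : Fin 3) x → ¬ Square (suc (toℕ a)) x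
  short a x sq with digits x
  ... | q , r , refl = σ₂-short _ _ (d-adjacent q) a r λ i →
    let i<1+a = toℕ<n i
        i≤2   = ℕ.s≤s⁻¹ (ℕ.≤-trans i<1+a (toℕ<n a))
    in trans (sym (d-window q r (ℕ.≤-trans i≤2 (ℕ.m≤n+m 2 3))))
         (trans (sq (toℕ i) i<1+a)
                (d-window q r (ℕ.+-mono-≤ i≤2 (toℕ<n a))))

  step : ∀ a → (∀ {b} → b ℕ.< a → ∀ x → 0 ℕ.< b → ¬ Square b x) → ∀ x → 0 ℕ.< a → ¬ Square a x
  step 1 _ x _ = short 0F x
  step 2 _ x _ = short 1F x
  step 3 _ x _ = short 2F x
  -- A period of at least 4 supplies the four equal letters that synchronisation requires.
  step a@(suc (suc (suc (suc _)))) rec x _ sq with prefix⇒5∣ a x (λ i i<4 → sq i (ℕ.≤-trans i<4 (ℕ.m≤m+n 4 _)))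
  ... | suc b , refl =
    let y , sq′ = desubstitute (suc b) x λ i i<a → sq i (ℕ.<-trans (ℕ.n<1+n i) i<a)
    in rec (ℕ.m<m*n (suc b) 5 (s≤s (s≤s z≤n))) y (s≤s z≤n) sq′

-- Period at least 5 still leaves four equalities, enough to synchronise; desubstitution then
-- restores a full square.
d-almostSquareFree : ∀ a x → 4 ℕ.< a → ¬ AlmostSquare a x
d-almostSquareFree a x 4<a sq with prefix⇒5∣ a x (λ i i<4 → sq i (ℕ.≤-trans (s≤s i<4) 4<a))
... | zero  , refl = contradiction 4<a λ ()
... | suc b , refl = let y , sq′ = desubstitute (suc b) x sq in d-squareFree (suc b) y (s≤s z≤n) sq′

-- Walks on the line and the edges they cross.

-- Rearranging an equation becomes a ring identity between differences, which the solver can prove.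
diff-≡ : ∀ {x y z w : ℤ} → x - y ≡ z - w → z ≡ w → x ≡ y
diff-≡ {x} {y} {z} e refl = i-j≡0⇒i≡j x y (trans e (+-inverseʳ z))

-- `P t` speaks of the edge {t, t + 1}, named by its lower end whichever way it is crossed.
WalkStep : (ℤ → Set) → ℤ → ℤ → Set
WalkStep P y y′ = y′ ≡ y ⊎ (y′ ≡ + 1 + y × P y) ⊎ (y ≡ + 1 + y′ × P y′)

stationary : ∀ n x → x ≡ + n + x → n ≡ 0
stationary n x eq = +-injective (diff-≡ (rearrange (+ n) x) (sym eq))
  where
  rearrange : ∀ n x → n - + 0 ≡ (n + x) - x
  rearrange = solve-∀

cancel-suc : ∀ n x y → + 1 + y ≡ + suc n + x → y ≡ + n + x
cancel-suc n x y = diff-≡ (rearrange (+ n) x y)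
  where
  rearrange : ∀ n x y → y - (n + x) ≡ (+ 1 + y) - (+ 1 + n + x)
  rearrange = solve-∀

suc-shift : ∀ n x → + n + (+ 1 + x) ≡ + suc n + x
suc-shift n x = rearrange (+ n) x
  where
  rearrange : ∀ n x → n + (+ 1 + x) ≡ + 1 + n + x
  rearrange = solve-∀

module _ (P : ℤ → Set) (f : ℕ → ℤ) where

  -- A discrete intermediate value theorem, by removing the last step: if it goes up it crosses the
  -- topmost edge, and if it goes down the shorter walk has climbed n + 1.
  walk-up : ∀ m n → (∀ i → i ℕ.< m → WalkStep P (f i) (f (suc i))) →
            f m ≡ + n + f 0 → ∀ i → i ℕ.< n → P (+ i + f 0)
  walk-up zero n _ eq i i<n with refl ← stationary n (f 0) eq = contradiction i<n λ ()
  walk-up (suc m) n step eq i i<n with step m (ℕ.n<1+n m)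
  ... | inj₁ same = walk-up m n (λ j j<m → step j (ℕ.m<n⇒m<1+n j<m)) (trans (sym same) eq) i i<n
  ... | inj₂ (inj₂ (down , _)) = walk-up m (suc n) (λ j j<m → step j (ℕ.m<n⇒m<1+n j<m))
      (trans down (trans (cong (_+_ (+ 1)) eq) (sym (+-assoc (+ 1) (+ n) (f 0))))) i (ℕ.m<n⇒m<1+n i<n)
  walk-up (suc m) (suc n) step eq i i<n | inj₂ (inj₁ (up , Pm)) with ℕ.m<1+n⇒m<n∨m≡n i<n
  ... | inj₁ i<n′ = walk-up m n (λ j j<m → step j (ℕ.m<n⇒m<1+n j<m)) (cancel-suc n (f 0) (f m) (trans (sym up) eq)) i i<n′
  ... | inj₂ refl = subst P (cancel-suc n (f 0) (f m) (trans (sym up) eq)) Pm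

  -- Removing the last step now moves the lower end of the interval, so the edge indices shift by
  -- one.
  walk-down : ∀ m n → (∀ i → i ℕ.< m → WalkStep P (f i) (f (suc i))) →
              f 0 ≡ + n + f m → ∀ i → i ℕ.< n → P (+ i + f m)
  walk-down zero n _ eq i i<n with refl ← stationary n (f 0) eq = contradiction i<n λ ()
  walk-down (suc m) n step eq i i<n with step m (ℕ.n<1+n m)
  ... | inj₁ same = subst (λ y → P (+ i + y)) (sym same)
      (walk-down m n (λ j j<m → step j (ℕ.m<n⇒m<1+n j<m)) (trans eq (cong (_+_ (+ n)) same)) i i<n)
  ... | inj₂ (inj₁ (up , _)) = subst P (trans (sym (suc-shift i (f m))) (cong (_+_ (+ i)) (sym up)))
      (walk-down m (suc n) (λ j j<m → step j (ℕ.m<n⇒m<1+n j<m))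
        (trans eq (trans (cong (_+_ (+ n)) up) (suc-shift n (f m)))) (suc i) (s≤s i<n))
  walk-down (suc m) (suc n) step eq zero i<n | inj₂ (inj₂ (down , Pm)) = subst P (sym (+-identityˡ _)) Pm
  walk-down (suc m) (suc n) step eq (suc i) i<n | inj₂ (inj₂ (down , _)) =
    subst P (trans (cong (_+_ (+ i)) down) (suc-shift i (f (suc m))))
      (walk-down m n (λ j j<m → step j (ℕ.m<n⇒m<1+n j<m))
        (trans eq (trans (sym (suc-shift n (f (suc m)))) (cong (_+_ (+ n)) (sym down)))) i (ℕ.s≤s⁻¹ i<n))

-- Translated walks and repetitions in `d`.

Shifted : ℤ → ℤ → Set
Shifted w z = d z ≡ d (w + z)

-- For negative w the repetition is read from its left end w + x, which makes the period positive.
shifted⇒repeat : ∀ w n x → (∀ i → i ℕ.< n → Shifted w (+ i + x)) →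
                 ∃[ y ] ∀ i → i ℕ.< n → d (+ i + y) ≡ d (+ (i ℕ.+ ∣ w ∣) + y)
shifted⇒repeat (+ a) n x eq = x , λ i i<n → trans (eq i i<n) (cong d (swap (+ a) (+ i) x))
  where
  swap : ∀ a i x → a + (i + x) ≡ i + a + x
  swap = solve-∀
shifted⇒repeat -[1+ a ] n x eq = -[1+ a ] + x , λ i i<n →
  trans (cong d (swap -[1+ a ] (+ i) x)) (trans (sym (eq i i<n)) (cong d (undo (+ suc a) (+ i) x)))
  where
  swap : ∀ w i x → i + (w + x) ≡ w + (i + x)
  swap = solve-∀
  undo : ∀ b i x → i + x ≡ i + b + (- b + x)
  undo = solve-∀

Edge : Fin 2 → ℤ → ℤ → Set
Edge 0F y y′ = y′ ≡ + 1 + y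
Edge 1F y y′ = y ≡ + 1 + y′

module _ (w : ℤ) (f : ℕ → ℤ) (m : ℕ) (step : ∀ i → i ℕ.< m → WalkStep (Shifted w) (f i) (f (suc i))) where

  up⇒repeat : ∀ n → f m ≡ + n + f 0 → ∃[ y ] ∀ i → i ℕ.< n → d (+ i + y) ≡ d (+ (i ℕ.+ ∣ w ∣) + y)
  up⇒repeat n eq = shifted⇒repeat w n (f 0) (walk-up (Shifted w) f m n step eq)

  down⇒repeat : ∀ n → f 0 ≡ + n + f m → ∃[ y ] ∀ i → i ℕ.< n → d (+ i + y) ≡ d (+ (i ℕ.+ ∣ w ∣) + y)
  down⇒repeat n eq = shifted⇒repeat w n (f m) (walk-down (Shifted w) f m n step eq)

-- The walk crosses all |w| edges between its ends, and their letters agree with those at distance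
-- w: a square of period |w| unless w = 0.
shift-trivial : ∀ w (f : ℕ → ℤ) m → (∀ i → i ℕ.< m → WalkStep (Shifted w) (f i) (f (suc i))) →
                f m ≡ w + f 0 → w ≡ + 0
shift-trivial (+ zero)    f m step eq = refl
shift-trivial w@(+ suc a) f m step eq =
  let y , sq = up⇒repeat w f m step (suc a) eq in ⊥-elim (d-squareFree (suc a) y (s≤s z≤n) sq)
shift-trivial w@(-[1+ a ]) f m step eq =
  let y , sq = down⇒repeat w f m step (suc a) (diff-≡ (rearrange (+ suc a) (f 0) (f m)) (sym eq))
  in ⊥-elim (d-squareFree (suc a) y (s≤s z≤n) sq)
  where
  rearrange : ∀ b x y → x - (b + y) ≡ (- b + x) - y
  rearrange = solve-∀

-- The last step of the walk is not known to repeat, which costs one letter of the square.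
shift-trivial-but-last : ∀ w (f : ℕ → ℤ) m b → (∀ i → i ℕ.< m → WalkStep (Shifted w) (f i) (f (suc i))) →
                         Edge b (f m) (w + f 0) → + 7 ∣ w → w ≡ + 0
shift-trivial-but-last w f m b step last 7∣w = go w b refl last
  where
  conclude : ∀ a n → ∣ w ∣ ≡ suc a → a ℕ.≤ n →
             (∃[ y ] ∀ i → i ℕ.< n → d (+ i + y) ≡ d (+ (i ℕ.+ ∣ w ∣) + y)) → w ≡ + 0
  conclude a n ∣w∣≡1+a a≤n (y , eq) = ⊥-elim (d-almostSquareFree ∣ w ∣ y 4<∣w∣ λ i 1+i<∣w∣ →
    eq i (ℕ.≤-trans (ℕ.s≤s⁻¹ (subst (suc i ℕ.<_) ∣w∣≡1+a 1+i<∣w∣)) a≤n))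
    where
    4<∣w∣ : 4 ℕ.< ∣ w ∣
    4<∣w∣ = ℕ.≤-trans (ℕ.m≤m+n 5 2)
      (∣⇒≤ {{subst NonZero (sym ∣w∣≡1+a) _}} (∣⇒∣ᵤ 7∣w))

  up₀ : ∀ a x y → y - (a + x) ≡ + 1 + y - (+ 1 + a + x)
  up₀ = solve-∀
  up₁ : ∀ a x y → y - (+ 1 + (+ 1 + a) + x) ≡ y - (+ 1 + (+ 1 + a + x))
  up₁ = solve-∀
  down₀ : ∀ a x y → x - (+ 1 + (+ 1 + a) + y) ≡ - (+ 1 + a) + x - (+ 1 + y)
  down₀ = solve-∀
  down₁ : ∀ a x y → x - (a + y) ≡ + 1 + (- (+ 1 + a) + x) - y
  down₁ = solve-∀

  go : ∀ v b → v ≡ w → Edge b (f m) (v + f 0) → w ≡ + 0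
  go (+ zero)   b  refl e = refl
  -- If the unknown edge points in the direction of w, the walk covers |w| - 1 edges; if it points
  -- the other way, |w| + 1.
  go (+ suc a)  0F refl e = conclude a a refl ℕ.≤-refl
    (up⇒repeat w f m step a (diff-≡ (up₀ (+ a) (f 0) (f m)) (sym e)))
  go (+ suc a)  1F refl e = conclude a (2 ℕ.+ a) refl (ℕ.m≤n+m a 2)
    (up⇒repeat w f m step (2 ℕ.+ a) (diff-≡ (up₁ (+ a) (f 0) (f m)) e))
  go (-[1+ a ]) 0F refl e = conclude a (2 ℕ.+ a) refl (ℕ.m≤n+m a 2)
    (down⇒repeat w f m step (2 ℕ.+ a) (diff-≡ (down₀ (+ a) (f 0) (f m)) e))
  go (-[1+ a ]) 1F refl e = conclude a a refl ℕ.≤-refl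
    (down⇒repeat w f m step a (diff-≡ (down₁ (+ a) (f 0) (f m)) (sym e)))

-- Moves in the three-dimensional grid.

V³ : Set
V³ = ℤ × ℤ × ℤ

coord : Fin 3 → V³ → ℤ
coord 0F (x , _ , _) = x
coord 1F (_ , y , _) = y
coord 2F (_ , _ , z) = z

record Move (b : Fin 2) (j : Fin 3) (u u′ : V³) : Set where
  constructor move
  field
    along : Edge b (coord j u) (coord j u′)
    fixed : ∀ l → l ≢ j → coord l u′ ≡ coord l u
open Move

adjP⇒edge : ∀ x y → AdjP x y → ∃[ b ] Edge b x y
adjP⇒edge x y a with x - y in eq
adjP⇒edge x y refl | + 1 = 1F , diff-≡ (rearrange x y) eq
  where
  rearrange : ∀ x y → x - (+ 1 + y) ≡ x - y - + 1
  rearrange = solve-∀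
adjP⇒edge x y refl | -[1+ 0 ] = 0F , diff-≡ (rearrange x y) (sym eq)
  where
  rearrange : ∀ x y → y - (+ 1 + x) ≡ - + 1 - (x - y)
  rearrange = solve-∀

adj⇒move : ∀ {u u′} → AdjP3 u u′ → ∃₂ λ b j → Move b j u u′
adj⇒move {x , y , z} {x′ , y′ , z′} (inj₁ (a , refl , refl)) = let b , e = adjP⇒edge x x′ a in
  b , 0F , move e λ { 0F l≢j → contradiction refl l≢j ; 1F _ → refl ; 2F _ → refl }
adj⇒move {x , y , z} {x′ , y′ , z′} (inj₂ (inj₁ (refl , a , refl))) = let b , e = adjP⇒edge y y′ a in
  b , 1F , move e λ { 0F _ → refl ; 1F l≢j → contradiction refl l≢j ; 2F _ → refl }
adj⇒move {x , y , z} {x′ , y′ , z′} (inj₂ (inj₂ (refl , refl , a))) = let b , e = adjP⇒edge z z′ a in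
  b , 2F , move e λ { 0F _ → refl ; 1F _ → refl ; 2F l≢j → contradiction refl l≢j }

-- The two colour functions and their increments.

total : (Fin 3 → ℤ → ℤ) → V³ → ℤ
total g u = g 0F (coord 0F u) + g 1F (coord 1F u) + g 2F (coord 2F u)

total-diff : ∀ g j {u u′} → (∀ l → l ≢ j → coord l u′ ≡ coord l u) →
             total g u′ - total g u ≡ g j (coord j u′) - g j (coord j u)
total-diff g j {u} {u′} fixed = go j fixed
  where
  g₀ = λ v → g 0F (coord 0F v)
  g₁ = λ v → g 1F (coord 1F v)
  g₂ = λ v → g 2F (coord 2F v)

  cancel₀ : ∀ a a′ b c → a′ + b + c - (a + b + c) ≡ a′ - a
  cancel₀ = solve-∀
  cancel₁ : ∀ a b b′ c → a + b′ + c - (a + b + c) ≡ b′ - b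
  cancel₁ = solve-∀
  cancel₂ : ∀ a b c c′ → a + b + c′ - (a + b + c) ≡ c′ - c
  cancel₂ = solve-∀

  go : ∀ j → (∀ l → l ≢ j → coord l u′ ≡ coord l u) → total g u′ - total g u ≡ g j (coord j u′) - g j (coord j u)
  go 0F e rewrite e 1F (λ ()) | e 2F (λ ()) = cancel₀ (g₀ u) (g₀ u′) (g₁ u) (g₂ u)
  go 1F e rewrite e 0F (λ ()) | e 2F (λ ()) = cancel₁ (g₀ u) (g₁ u) (g₁ u′) (g₂ u)
  go 2F e rewrite e 0F (λ ()) | e 1F (λ ()) = cancel₂ (g₀ u) (g₁ u) (g₂ u) (g₂ u′)

h : ℤ → ℤ
h (+ zero)       = + 0
h (+ suc n)      = h (+ n) + + toℕ (d (+ n))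
h -[1+ zero ]    = - + toℕ (d -[1+ 0 ])
h -[1+ suc n ]   = h -[1+ n ] - + toℕ (d -[1+ suc n ])

h-suc : ∀ x → h (+ 1 + x) - h x ≡ + toℕ (d x)
h-suc (+ n) = cancel (h (+ n)) (+ toℕ (d (+ n)))
  where
  cancel : ∀ a b → a + b - a ≡ b
  cancel = solve-∀
h-suc -[1+ zero ]  = refl
h-suc -[1+ suc n ] = cancel (h -[1+ n ]) (+ toℕ (d -[1+ suc n ]))
  where
  cancel : ∀ a b → a - (a - b) ≡ b
  cancel = solve-∀

weight : Fin 3 → ℤ → ℤ
weight j x = + suc (toℕ j) * x

φ ψ : V³ → ℤ
φ = total weight
ψ = total λ _ → h

jump : Fin 2 → Fin 3 → ℤ
jump 0F j = + suc (toℕ j)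
jump 1F j = -[1+ toℕ j ]

-- The jumps ±1, ±2, ±3 are the six nonzero residues mod 7, one for each direction.
jump-injective : ∀ b c j k → + 7 ∣ jump b j - jump c k → b ≡ c × j ≡ k
jump-injective = from-yes (all? λ b → all? λ c → all? λ j → all? λ k →
  (+ 7 ∣? (jump b j - jump c k)) →-dec ((b ≟ c) ×-dec (j ≟ k)))

φ-move : ∀ b j {u u′} → Move b j u u′ → φ u′ - φ u ≡ jump b j
φ-move b j {u} {u′} m = trans (total-diff weight j (fixed m)) (go b (along m))
  where
  up : ∀ c x → c * (+ 1 + x) - c * x ≡ c
  up = solve-∀
  down : ∀ c x → c * x - c * (+ 1 + x) ≡ - c
  down = solve-∀

  go : ∀ b {x y} → Edge b x y → + suc (toℕ j) * y - + suc (toℕ j) * x ≡ jump b j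
  go 0F {x} refl = up (+ suc (toℕ j)) x
  go 1F {y = y} refl = down (+ suc (toℕ j)) y

mod4-injective : ∀ (p p′ : Fin 4) → + 4 ∣ + toℕ p - + toℕ p′ → p ≡ p′
mod4-injective = from-yes (all? λ (p : Fin 4) → all? λ (p′ : Fin 4) → (+ 4 ∣? (+ toℕ p - + toℕ p′)) →-dec (p ≟ p′))

base : Fin 2 → ℤ → ℤ → ℤ
base 0F y y′ = y
base 1F y y′ = y′

-- Along an edge `h` changes by plus or minus the letter at the lower end, with the same sign for
-- two edges of equal direction.
h-edge : ∀ b {x x′ y y′} → Edge b x x′ → Edge b y y′ → + 4 ∣ (h x′ - h x) - (h y′ - h y) →
         d (base b x x′) ≡ d (base b y y′)
h-edge 0F {x} {y = y} refl refl 4∣ =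
  mod4-injective _ _ (subst (+ 4 ∣_) (cong₂ _-_ (h-suc x) (h-suc y)) 4∣)
h-edge 1F {x′ = x} {y′ = y} refl refl 4∣ =
  sym (mod4-injective _ _ (subst (+ 4 ∣_)
    (trans (flip (h (+ 1 + x)) (h x) (h (+ 1 + y)) (h y)) (cong₂ _-_ (h-suc y) (h-suc x))) 4∣))
  where
  flip : ∀ x′ x y′ y → (x - x′) - (y - y′) ≡ (y′ - y) - (x′ - x)
  flip = solve-∀

∣-cross : ∀ n a a′ b b′ → n ∣ a - b → n ∣ a′ - b′ → n ∣ (a′ - a) - (b′ - b)
∣-cross n a a′ b b′ p p′ = subst (n ∣_) (regroup a a′ b b′) (∣m∣n⇒∣m-n p′ p)
  where
  regroup : ∀ a a′ b b′ → (a′ - b′) - (a - b) ≡ (a′ - a) - (b′ - b)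
  regroup = solve-∀

-- Decoding paired steps.

record SameColour (u t : V³) : Set where
  field
    φ-∣ : + 7 ∣ φ u - φ t
    ψ-∣ : + 4 ∣ ψ u - ψ t
open SameColour

Translate : (Fin 3 → ℤ) → V³ → V³ → Set
Translate w u t = ∀ l → coord l t ≡ w l + coord l u

translate-move : ∀ w {b j u u′ t t′} → Translate w u t → Move b j u u′ → Move b j t t′ → Translate w u′ t′
translate-move w {b} {j} {u} {u′} {t} {t′} tr m n l with l ≟ j
... | no l≢j = trans (fixed n l l≢j) (trans (tr l) (cong (_+_ (w l)) (sym (fixed m l l≢j))))
... | yes refl = go b (along m) (along n)
  where

  go : ∀ b → Edge b (coord l u) (coord l u′) → Edge b (coord l t) (coord l t′) → coord l t′ ≡ w l + coord l u′
  go 0F e e′ = begin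
    coord l t′                   ≡⟨ e′ ⟩
    + 1 + coord l t              ≡⟨ cong (_+_ (+ 1)) (tr l) ⟩
    + 1 + (w l + coord l u)      ≡⟨ swap (w l) (coord l u) ⟩
    w l + (+ 1 + coord l u)      ≡⟨ cong (_+_ (w l)) e ⟨
    w l + coord l u′             ∎
    where
    swap : ∀ w x → + 1 + (w + x) ≡ w + (+ 1 + x)
    swap = solve-∀
  go 1F e e′ = diff-≡ (lift (w l) (coord l u′) (coord l t′)) (begin
    + 1 + coord l t′             ≡⟨ e′ ⟨
    coord l t                    ≡⟨ tr l ⟩
    w l + coord l u              ≡⟨ cong (_+_ (w l)) e ⟩
    w l + (+ 1 + coord l u′)     ∎)
    where
    lift : ∀ w x y → y - (w + x) ≡ + 1 + y - (w + (+ 1 + x))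
    lift = solve-∀

-- The residues mod 7 force both steps to be the same move, so the translation persists; the
-- residues mod 4 then compare the letters of the two crossed edges.
decode : ∀ w {u u′ t t′} → AdjP3 u u′ → AdjP3 t t′ → SameColour u t → SameColour u′ t′ →
         Translate w u t → Translate w u′ t′ × (∀ l → WalkStep (Shifted (w l)) (coord l u) (coord l u′))
decode w {u} {u′} {t} {t′} a a′ same same′ tr
  with b , j , m ← adj⇒move a | c , k , n ← adj⇒move a′
  with refl , refl ← jump-injective b c j k (subst (+ 7 ∣_) (cong₂ _-_ (φ-move b j m) (φ-move c k n))
                       (∣-cross (+ 7) (φ u) (φ u′) (φ t) (φ t′) (φ-∣ same) (φ-∣ same′)))
  = tr′ , walk
  where
  tr′ : Translate w u′ t′
  tr′ = translate-move w tr m n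

  d-eq : d (base b (coord j u) (coord j u′)) ≡ d (base b (coord j t) (coord j t′))
  d-eq = h-edge b (along m) (along n)
    (subst (+ 4 ∣_) (cong₂ _-_ (total-diff (λ _ → h) j (fixed m)) (total-diff (λ _ → h) j (fixed n)))
      (∣-cross (+ 4) (ψ u) (ψ u′) (ψ t) (ψ t′) (ψ-∣ same) (ψ-∣ same′)))

  walk : ∀ l → WalkStep (Shifted (w l)) (coord l u) (coord l u′)
  walk l with l ≟ j
  ... | no l≢j = inj₁ (fixed m l l≢j)
  ... | yes refl = go b (along m) d-eq
    where
    go : ∀ b → Edge b (coord l u) (coord l u′) → d (base b (coord l u) (coord l u′)) ≡ d (base b (coord l t) (coord l t′)) →
         WalkStep (Shifted (w l)) (coord l u) (coord l u′)
    go 0F e eq = inj₂ (inj₁ (e , trans eq (cong d (tr l))))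
    -- The lower end of a downward step is its endpoint, hence the translation after the step.
    go 1F e eq = inj₂ (inj₂ (e , trans eq (cong d (tr′ l))))

-- The colouring with 4 · 7 colours.

residue : ∀ n .{{_ : NonZero n}} → ℤ → Fin n
residue n z = fromℕ< (n%ℕd<d z n)

residue-≡ : ∀ n .{{_ : NonZero n}} y z → residue n y ≡ residue n z → + n ∣ y - z
residue-≡ n y z eq = divides (y /ℕ n - z /ℕ n) (begin
  y - z                                                          ≡⟨ cong₂ _-_ (a≡a%ℕn+[a/ℕn]*n y n) (a≡a%ℕn+[a/ℕn]*n z n) ⟩
  (+ (y %ℕ n) + y /ℕ n * + n) - (+ (z %ℕ n) + z /ℕ n * + n)      ≡⟨ cong (λ r → (+ r + y /ℕ n * + n) - (+ (z %ℕ n) + z /ℕ n * + n)) r≡ ⟩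
  (+ (z %ℕ n) + y /ℕ n * + n) - (+ (z %ℕ n) + z /ℕ n * + n)      ≡⟨ factor (+ (z %ℕ n)) (y /ℕ n) (z /ℕ n) (+ n) ⟩
  (y /ℕ n - z /ℕ n) * + n                                        ∎)
  where
  r≡ : y %ℕ n ≡ z %ℕ n
  r≡ = fromℕ<-injective _ _ (n%ℕd<d y n) (n%ℕd<d z n) eq
  factor : ∀ r p q n → (r + p * n) - (r + q * n) ≡ (p - q) * n
  factor = solve-∀

colour : V³ → Fin 28
colour v = combine (residue 4 (ψ v)) (residue 7 (φ v))

colour-≡ : ∀ u t → colour u ≡ colour t → SameColour u t
colour-≡ u t eq = let e₄ , e₇ = combine-injective (residue 4 (ψ u)) (residue 7 (φ u)) _ _ eq in
  record { φ-∣ = residue-≡ 7 (φ u) (φ t) e₇ ; ψ-∣ = residue-≡ 4 (ψ u) (ψ t) e₄ }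

coord-ext : ∀ {u v} → (∀ l → coord l u ≡ coord l v) → u ≡ v
coord-ext e = cong₂ _,_ (e 0F) (cong₂ _,_ (e 1F) (e 2F))

7∣-cancel : ∀ (j : Fin 3) x → + 7 ∣ + suc (toℕ j) * x → + 7 ∣ x
7∣-cancel j x p = ∣ᵤ⇒∣ (coprime-divisor (+ 7) (+ suc (toℕ j)) x (coprime j) (∣⇒∣ᵤ p))
  where
  coprime : ∀ (j : Fin 3) → Coprime 7 (suc (toℕ j))
  coprime 0F = from-yes (coprime? 7 1)
  coprime 1F = from-yes (coprime? 7 2)
  coprime 2F = from-yes (coprime? 7 3)

-- Closing a repetitively coloured walk.

repeated-walk-closes : ∀ m (v : ℕ → V³) → (∀ i → suc i ℕ.< suc m ℕ.+ suc m → AdjP3 (v i) (v (suc i))) →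
                       (∀ i → i ℕ.< suc m → SameColour (v i) (v (suc m ℕ.+ i))) → v (suc m) ≡ v 0
repeated-walk-closes m v adj same = close
  where
  k = suc m

  w : Fin 3 → ℤ
  w l = coord l (v k) - coord l (v 0)

  start : ∀ x y → y ≡ y - x + x
  start = solve-∀

  step : ∀ i → suc i ℕ.< k → Translate w (v i) (v (k ℕ.+ i)) →
         Translate w (v (suc i)) (v (k ℕ.+ suc i)) × (∀ l → WalkStep (Shifted (w l)) (coord l (v i)) (coord l (v (suc i))))
  step i 1+i<k = decode w
    (adj i (ℕ.≤-trans 1+i<k (ℕ.m≤m+n k k)))
    (subst (λ n → AdjP3 (v (k ℕ.+ i)) (v n)) (sym (ℕ.+-suc k i))
      (adj (k ℕ.+ i) (subst (ℕ._< k ℕ.+ k) (ℕ.+-suc k i) (ℕ.+-monoʳ-< k 1+i<k))))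
    (same i (ℕ.<-trans (ℕ.n<1+n i) 1+i<k))
    (same (suc i) 1+i<k)

  translate : ∀ i → i ℕ.< k → Translate w (v i) (v (k ℕ.+ i))
  translate zero    _     l = trans (cong (λ n → coord l (v n)) (ℕ.+-identityʳ k)) (start (coord l (v 0)) (coord l (v k)))
  translate (suc i) 1+i<k = proj₁ (step i 1+i<k (translate i (ℕ.<-trans (ℕ.n<1+n i) 1+i<k)))

  -- Only the m steps inside the first half have partners; the middle step from `v m` to `v k` is
  -- treated separately.
  walk : ∀ l i → i ℕ.< m → WalkStep (Shifted (w l)) (coord l (v i)) (coord l (v (suc i)))
  walk l i i<m = proj₂ (step i (s≤s i<m) (translate i (ℕ.m<n⇒m<1+n i<m))) l

  close : v k ≡ v 0
  close with b , j , last ← adj⇒move (adj m (s≤s (ℕ.m≤n+m k m))) = coord-ext λ l → i-j≡0⇒i≡j _ _ (w≡0 l)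
    where
    off-axis : ∀ l → l ≢ j → w l ≡ + 0
    off-axis l l≢j = shift-trivial (w l) (λ i → coord l (v i)) m (walk l)
      (trans (sym (fixed last l l≢j)) (start (coord l (v 0)) (coord l (v k))))

    factor : ∀ c x y → c * y - c * x ≡ c * (y - x)
    factor = solve-∀

    negate : ∀ x y → - (x - y) ≡ y - x
    negate = solve-∀

    -- All other components of w vanish, so the congruence of `φ (v 0)` and `φ (v k)` concerns the
    -- weight of axis j times `w j` alone.
    7∣w : + 7 ∣ w j
    7∣w = 7∣-cancel j (w j) (subst (+ 7 ∣_)
      (trans (negate (φ (v 0)) (φ (v k)))
      (trans (total-diff weight j {v 0} {v k} λ l l≢j → i-j≡0⇒i≡j _ _ (off-axis l l≢j))
        (factor (+ suc (toℕ j)) (coord j (v 0)) (coord j (v k)))))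
      (∣m⇒∣-m (subst (λ n → + 7 ∣ φ (v 0) - φ (v n)) (ℕ.+-identityʳ k) (φ-∣ (same 0 (s≤s z≤n))))))

    on-axis : w j ≡ + 0
    on-axis = shift-trivial-but-last (w j) (λ i → coord j (v i)) m b (walk j)
      (subst (Edge b (coord j (v m))) (start (coord j (v 0)) (coord j (v k))) (along last)) 7∣w

    w≡0 : ∀ l → w l ≡ + 0
    w≡0 l with l ≟ j
    ... | yes refl = on-axis
    ... | no l≢j   = off-axis l l≢j

-- From paths indexed by `Fin` to the theorem.

module Extend {k} (p : Fin (suc k) → V³) where

  v : ℕ → V³
  v i with i ℕ.<? suc k
  ... | yes i<k = p (fromℕ< i<k)
  -- An arbitrary value beyond the end of the path.
  ... | no  _   = p 0F

  v-≡ : ∀ i (i<k : i ℕ.< suc k) → v i ≡ p (fromℕ< i<k)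
  v-≡ i i<k with i ℕ.<? suc k
  ... | yes i<k′ = refl
  ... | no i≮k   = contradiction i<k i≮k

theorem5 : πLe P³ 28
theorem5 = colour , nonRepetitive
  where
  nonRepetitive : NonRepetitive P³ colour
  -- The vertices at positions 0 and k ≥ 1 coincide, against distinctness.
  nonRepetitive (suc m) _ p path rep = k≢0 (IsPath.distinct path (begin
    p (fromℕ< k<2k)   ≡⟨ v-≡ k k<2k ⟨
    v k               ≡⟨ repeated-walk-closes m v adj same ⟩
    v 0               ≡⟨ v-≡ 0 (s≤s z≤n) ⟩
    p 0F              ∎))
    where
    open Extend p
    k = suc m
    k<2k : k ℕ.< k ℕ.+ k
    k<2k = ℕ.m<m+n k (s≤s z≤n)

    k≢0 : fromℕ< k<2k ≢ 0F
    k≢0 ()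

    adj : ∀ i → suc i ℕ.< k ℕ.+ k → AdjP3 (v i) (v (suc i))
    adj i 1+i<2k = subst₂ AdjP3 (sym (v-≡ i i<2k)) (sym (v-≡ (suc i) 1+i<2k))
      (IsPath.adjacent path _ _ (trans (toℕ-fromℕ< 1+i<2k) (cong suc (sym (toℕ-fromℕ< i<2k)))))
      where i<2k = ℕ.<-trans (ℕ.n<1+n i) 1+i<2k

    same : ∀ i → i ℕ.< k → SameColour (v i) (v (k ℕ.+ i))
    same i i<k = colour-≡ _ _ (begin
      colour (v i)                       ≡⟨ cong colour (v-≡ i i<2k) ⟩
      colour (p (fromℕ< i<2k))           ≡⟨ rep i i<2k k+i<2k i<k ⟩
      colour (p (fromℕ< k+i<2k))         ≡⟨ cong colour (v-≡ (k ℕ.+ i) k+i<2k) ⟨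
      colour (v (k ℕ.+ i))               ∎)
      where
      i<2k = ℕ.≤-trans i<k (ℕ.m≤m+n k k)
      k+i<2k = ℕ.+-monoʳ-< k i<k
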